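{- For all formulas $A,B$, the following are equivalent: (1) ${\sf AR}^{\sf A}_{\sf par}\vdash A\rhd B$; (2) $A\rhd_{{\sf NNIL}({\sf par})}B$; (3) $\vdash A^\star\to B$.
   Context: Language: $\wedge,\vee,\to,\bot$ over finite atoms ${\sf atom}={\sf var}\cup{\sf par}$ (disjoint variables and parameters); $\vdash$ is ${\sf IPC}$-derivability. Substitutions commute with connectives, fix $\bot$ and fix every parameter. ${\sf NNIL}$ is the least class containing atoms, $\bot,\top$, closed under $\wedge,\vee$, and containing $B\to C$ whenever $C\in{\sf NNIL}$ and $B$ is built from atoms, $\bot,\top$ by $\wedge,\vee$ only; ${\sf NNIL}({\sf par})$: those whose atoms are all parameters. Preservativity: $A\rhd_\Gamma B$ iff for every $E\in\Gamma$, $\vdash E\to A$ implies $\vdash E\to B$. ${\sf AR}^{\sf A}_{\sf par}$ derives statements $A\rhd B$ from: Ax ($A\rhd B$ whenever $\vdash A\to B$); ${\sf V}$: $(B\to C)\rhd\bigvee_{i=1}^{n+m}B[E_i]$ with $B=\bigwedge_{i=1}^n(E_i\to F_i)$, $C=\bigvee_{i=n+1}^{n+m}E_i$, $B[E]:=E$ if $E\in{\sf par}\cup\{\bot\}$ and $B\to E$ otherwise; ${\sf sub}$: $A\rhd\theta(A)$ for every substitution $\theta$; rules Conj ($A\rhd B$, $A\rhd C$ / $A\rhd B\wedge C$), Cut ($A\rhd B$, $B\rhd C$ / $A\rhd C$), Disj ($B\rhd A$, $C\rhd A$ / $B\vee C\rhd A$), Mont$({\sf par})$ ($A\rhd B$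 / $(p\to A)\rhd(p\to B)$ for $p\in{\sf par}$). $A^\star$ denotes the formula effectively computed from $A$ that satisfies: $A^\star\in{\sf NNIL}({\sf par})$, ${\sf IPC}\vdash A^\star\to A$, ${\sf AR}^{\sf A}_{\sf par}\vdash A\rhd A^\star$, and every atom of $A^\star$ occurs in $A$. -}

module Defs where

open import Data.Nat using (ℕ)
open import Data.Fin using (Fin)
open import Data.List using (List; []; _∷_; _++_)
open import Data.List.Membership.Propositional using (_∈_)
open import Data.Product using (_×_; _,_)
open import Data.Empty using (⊥)
open import Data.Unit using (⊤)
open import Function.Bundles using (_⇔_)

data Atom (nv np : ℕ) : Set where
  var : Fin nv → Atom nv np
  par : Fin np → Atom nv np

data Fm (nv np : ℕ) : Set where
  at   : Atom nv np → Fm nv np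
  ⊥̇    : Fm nv np
  _∧̇_  : Fm nv np → Fm nv np → Fm nv np
  _∨̇_  : Fm nv np → Fm nv np → Fm nv np
  _⇒_  : Fm nv np → Fm nv np → Fm nv np

infixr 6 _∧̇_
infixr 5 _∨̇_
infixr 4 _⇒_

module _ {nv np : ℕ} where

  ⊤̇ : Fm nv np
  ⊤̇ = ⊥̇ ⇒ ⊥̇

  ⋀ : List (Fm nv np) → Fm nv np
  ⋀ []           = ⊤̇
  ⋀ (x ∷ [])     = x
  ⋀ (x ∷ y ∷ xs) = x ∧̇ ⋀ (y ∷ xs)

  ⋁ : List (Fm nv np) → Fm nv np
  ⋁ []           = ⊥̇
  ⋁ (x ∷ [])     = x
  ⋁ (x ∷ y ∷ xs) = x ∨̇ ⋁ (y ∷ xs)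

  infix 2 _⊢_
  data _⊢_ (Γ : List (Fm nv np)) : Fm nv np → Set where
    hyp  : ∀ {A} → A ∈ Γ → Γ ⊢ A
    ⇒I   : ∀ {A B} → (A ∷ Γ) ⊢ B → Γ ⊢ A ⇒ B
    ⇒E   : ∀ {A B} → Γ ⊢ A ⇒ B → Γ ⊢ A → Γ ⊢ B
    ∧I   : ∀ {A B} → Γ ⊢ A → Γ ⊢ B → Γ ⊢ A ∧̇ B
    ∧E₁  : ∀ {A B} → Γ ⊢ A ∧̇ B → Γ ⊢ A
    ∧E₂  : ∀ {A B} → Γ ⊢ A ∧̇ B → Γ ⊢ B
    ∨I₁  : ∀ {A B} → Γ ⊢ A → Γ ⊢ A ∨̇ B
    ∨I₂  : ∀ {A B} → Γ ⊢ B → Γ ⊢ A ∨̇ B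
    ∨E   : ∀ {A B C} → Γ ⊢ A ∨̇ B → (A ∷ Γ) ⊢ C → (B ∷ Γ) ⊢ C → Γ ⊢ C
    ⊥E   : ∀ {A} → Γ ⊢ ⊥̇ → Γ ⊢ A

  IPC⊢ : Fm nv np → Set
  IPC⊢ A = [] ⊢ A

  Subst : Set
  Subst = Fin nv → Fm nv np

  _[_] : Fm nv np → Subst → Fm nv np
  at (var x) [ θ ] = θ x
  at (par p) [ θ ] = at (par p)
  ⊥̇ [ θ ]          = ⊥̇
  (A ∧̇ B) [ θ ]    = (A [ θ ]) ∧̇ (B [ θ ])
  (A ∨̇ B) [ θ ]    = (A [ θ ]) ∨̇ (B [ θ ])
  (A ⇒ B) [ θ ]    = (A [ θ ]) ⇒ (B [ θ ])

  data Occ (a : Atom nv np) : Fm nv np → Set where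
    here : Occ a (at a)
    ∧ₗ : ∀ {A B} → Occ a A → Occ a (A ∧̇ B)
    ∧ᵣ : ∀ {A B} → Occ a B → Occ a (A ∧̇ B)
    ∨ₗ : ∀ {A B} → Occ a A → Occ a (A ∨̇ B)
    ∨ᵣ : ∀ {A B} → Occ a B → Occ a (A ∨̇ B)
    ⇒ₗ : ∀ {A B} → Occ a A → Occ a (A ⇒ B)
    ⇒ᵣ : ∀ {A B} → Occ a B → Occ a (A ⇒ B)

  IsPar : Atom nv np → Set
  IsPar (var _) = ⊥
  IsPar (par _) = ⊤

  data Pos : Fm nv np → Set where
    atₚ : ∀ a → Pos (at a)
    ⊥ₚ  : Pos ⊥̇
    ⊤ₚ  : Pos ⊤̇
    ∧ₚ  : ∀ {A B} → Pos A → Pos B → Pos (A ∧̇ B)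
    ∨ₚ  : ∀ {A B} → Pos A → Pos B → Pos (A ∨̇ B)

  data NNIL : Fm nv np → Set where
    atₙ : ∀ a → NNIL (at a)
    ⊥ₙ  : NNIL ⊥̇
    ⊤ₙ  : NNIL ⊤̇
    ∧ₙ  : ∀ {A B} → NNIL A → NNIL B → NNIL (A ∧̇ B)
    ∨ₙ  : ∀ {A B} → NNIL A → NNIL B → NNIL (A ∨̇ B)
    ⇒ₙ  : ∀ {B C} → Pos B → NNIL C → NNIL (B ⇒ C)

  NNILpar : Fm nv np → Set
  NNILpar A = NNIL A × (∀ a → Occ a A → IsPar a)

  Pres : (Fm nv np → Set) → Fm nv np → Fm nv np → Set
  Pres Γ A B = ∀ E → Γ E → IPC⊢ (E ⇒ A) → IPC⊢ (E ⇒ B)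

  _⟦_⟧ : Fm nv np → Fm nv np → Fm nv np
  B ⟦ at (par p) ⟧ = at (par p)
  B ⟦ ⊥̇ ⟧          = ⊥̇
  B ⟦ E ⟧          = B ⇒ E

  map⟦⟧ : Fm nv np → List (Fm nv np) → List (Fm nv np)
  map⟦⟧ B []       = []
  map⟦⟧ B (E ∷ Es) = (B ⟦ E ⟧) ∷ map⟦⟧ B Es

  imps : List (Fm nv np × Fm nv np) → List (Fm nv np)
  imps []             = []
  imps ((E , F) ∷ xs) = (E ⇒ F) ∷ imps xs

  antes : List (Fm nv np × Fm nv np) → List (Fm nv np)
  antes []             = []
  antes ((E , F) ∷ xs) = E ∷ antes xs

  infix 2 AR⊢_▷_
  data AR⊢_▷_ : Fm nv np → Fm nv np → Set where
    Ax   : ∀ {A B} → IPC⊢ (A ⇒ B) → AR⊢ A ▷ B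
    -- V: EFs = (E₁,F₁),…,(Eₙ,Fₙ);  Es = E_{n+1},…,E_{n+m}
    V    : (EFs : List (Fm nv np × Fm nv np)) (Es : List (Fm nv np)) →
           AR⊢ (⋀ (imps EFs) ⇒ ⋁ Es) ▷ ⋁ (map⟦⟧ (⋀ (imps EFs)) (antes EFs ++ Es))
    sub  : ∀ {A} (θ : Subst) → AR⊢ A ▷ (A [ θ ])
    Conj : ∀ {A B C} → AR⊢ A ▷ B → AR⊢ A ▷ C → AR⊢ A ▷ (B ∧̇ C)
    Cut  : ∀ {A B C} → AR⊢ A ▷ B → AR⊢ B ▷ C → AR⊢ A ▷ C
    Disj : ∀ {A B C} → AR⊢ B ▷ A → AR⊢ C ▷ A → AR⊢ (B ∨̇ C) ▷ A
    Mont : ∀ {A B} (p : Fin np) → AR⊢ A ▷ B → AR⊢ (at (par p) ⇒ A) ▷ (at (par p) ⇒ B)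

  IsStar : (Fm nv np → Fm nv np) → Set
  IsStar ⋆ = ∀ A → NNILpar (⋆ A)
               × IPC⊢ (⋆ A ⇒ A)
               × (AR⊢ A ▷ ⋆ A)
               × (∀ a → Occ a (⋆ A) → Occ a A)

{-# OPTIONS --safe #-}
-- Only the soundness direction (1) ⇒ (2) has content; the other implications are read off
-- from the properties of A⋆. Soundness is proved for contexts of NNIL(par) formulas instead of
-- single formulas. Disj and V rest on the following: every such context is covered by
-- finitely many saturated ones, consisting of atoms X and implications P ⇒ C with P positive and
-- false under the valuation X, and saturated contexts have the extended disjunction
-- property expressed by V. The latter is shown with an Aczel slash in place of gluing
-- Kripke models below a new root with valuation X.
module Submission where

open import Defs
open import Data.Nat using (ℕ; zero; suc; _+_; _<_; s≤s)
open import Data.Nat.Properties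
  using (+-assoc; m≤m+n; m≤n+m; n<1+n; +-monoˡ-<; <-≤-trans; ≤-pred)
open import Data.Nat.ListAction using (sum)
open import Data.Nat.ListAction.Properties using (sum-↭)
open import Data.Fin.Properties using () renaming (_≟_ to _≟ᶠ_)
open import Data.List using (List; []; _∷_; _++_; map)
open import Data.List.Properties using (++-identityʳ)
open import Data.List.Membership.Propositional using (_∈_; find)
open import Data.List.Membership.Propositional.Properties using (∈-map⁺; ∈-map⁻; ∈-++⁺ʳ; ∈-++⁻; ∈-∃++)
open import Data.List.Relation.Binary.Permutation.Propositional using (_↭_; ↭-sym)
open import Data.List.Relation.Binary.Permutation.Propositional.Properties
  using (shift; map⁺; ++⁺ʳ; ∈-resp-↭; All-resp-↭)
open import Data.List.Relation.Binary.Subset.Propositional using (_⊆_)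
open import Data.List.Relation.Binary.Subset.Propositional.Properties using (∷⁺ʳ)
open import Data.List.Relation.Unary.All as All using (All; []; _∷_)
import Data.List.Relation.Unary.All.Properties as All
open import Data.List.Relation.Unary.Any as Any using (Any; here; there)
import Data.List.Relation.Unary.Any.Properties as Any
open import Data.Product using (_×_; _,_; proj₁; proj₂)
open import Data.Sum using (_⊎_; inj₁; inj₂; [_,_]′; map₁)
open import Data.Empty using (⊥; ⊥-elim)
open import Data.Unit using (tt)
open import Function.Base using (_∘_; id)
open import Function.Bundles using (_⇔_; mk⇔)
open import Relation.Binary.Definitions using (DecidableEquality)
open import Relation.Binary.PropositionalEquality using (_≡_; refl; cong; cong₂; sym; subst)
open import Relation.Nullary using (¬_; Dec; yes; no)
open import Relation.Nullary.Decidable using (map′; _×-dec_; _⊎-dec_; _→-dec_)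

module _ {nv np : ℕ} where

  private
    F : Set
    F = Fm nv np

    variable
      A B C : F
      Γ Δ : List F

  -- Structural rules and substitution in natural deduction

  rename : Γ ⊆ Δ → Γ ⊢ A → Δ ⊢ A
  rename ρ (hyp i)    = hyp (ρ i)
  rename ρ (⇒I d)     = ⇒I (rename (∷⁺ʳ _ ρ) d)
  rename ρ (⇒E d e)   = ⇒E (rename ρ d) (rename ρ e)
  rename ρ (∧I d e)   = ∧I (rename ρ d) (rename ρ e)
  rename ρ (∧E₁ d)    = ∧E₁ (rename ρ d)
  rename ρ (∧E₂ d)    = ∧E₂ (rename ρ d)
  rename ρ (∨I₁ d)    = ∨I₁ (rename ρ d)
  rename ρ (∨I₂ d)    = ∨I₂ (rename ρ d)
  rename ρ (∨E d e f) = ∨E (rename ρ d) (rename (∷⁺ʳ _ ρ) e) (rename (∷⁺ʳ _ ρ) f)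
  rename ρ (⊥E d)     = ⊥E (rename ρ d)

  weaken : Γ ⊢ A → (B ∷ Γ) ⊢ A
  weaken = rename there

  infix 2 _⊢*_
  _⊢*_ : List F → List F → Set
  Γ ⊢* Δ = ∀ {A} → A ∈ Δ → Γ ⊢ A

  ∷-⊢* : Γ ⊢ A → Γ ⊢* Δ → Γ ⊢* (A ∷ Δ)
  ∷-⊢* d σ (here refl) = d
  ∷-⊢* d σ (there i)   = σ i

  lift-⊢* : Γ ⊢* Δ → (A ∷ Γ) ⊢* (A ∷ Δ)
  lift-⊢* σ = ∷-⊢* (hyp (here refl)) (weaken ∘ σ)

  cut : Γ ⊢* Δ → Δ ⊢ A → Γ ⊢ A
  cut σ (hyp i)    = σ i
  cut σ (⇒I d)     = ⇒I (cut (lift-⊢* σ) d)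
  cut σ (⇒E d e)   = ⇒E (cut σ d) (cut σ e)
  cut σ (∧I d e)   = ∧I (cut σ d) (cut σ e)
  cut σ (∧E₁ d)    = ∧E₁ (cut σ d)
  cut σ (∧E₂ d)    = ∧E₂ (cut σ d)
  cut σ (∨I₁ d)    = ∨I₁ (cut σ d)
  cut σ (∨I₂ d)    = ∨I₂ (cut σ d)
  cut σ (∨E d e f) = ∨E (cut σ d) (cut (lift-⊢* σ) e) (cut (lift-⊢* σ) f)
  cut σ (⊥E d)     = ⊥E (cut σ d)

  apply : IPC⊢ (A ⇒ B) → Γ ⊢ A → Γ ⊢ B
  apply d = ⇒E (rename (λ ()) d)

  ⇒I⁻¹ : Γ ⊢ A ⇒ B → (A ∷ Γ) ⊢ B
  ⇒I⁻¹ d = ⇒E (weaken d) (hyp (here refl))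

  ⊢-[] : (θ : Subst) → Γ ⊢ A → map (_[ θ ]) Γ ⊢ A [ θ ]
  ⊢-[] θ (hyp i)    = hyp (∈-map⁺ (_[ θ ]) i)
  ⊢-[] θ (⇒I d)     = ⇒I (⊢-[] θ d)
  ⊢-[] θ (⇒E d e)   = ⇒E (⊢-[] θ d) (⊢-[] θ e)
  ⊢-[] θ (∧I d e)   = ∧I (⊢-[] θ d) (⊢-[] θ e)
  ⊢-[] θ (∧E₁ d)    = ∧E₁ (⊢-[] θ d)
  ⊢-[] θ (∧E₂ d)    = ∧E₂ (⊢-[] θ d)
  ⊢-[] θ (∨I₁ d)    = ∨I₁ (⊢-[] θ d)
  ⊢-[] θ (∨I₂ d)    = ∨I₂ (⊢-[] θ d)
  ⊢-[] θ (∨E d e f) = ∨E (⊢-[] θ d) (⊢-[] θ e) (⊢-[] θ f)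
  ⊢-[] θ (⊥E d)     = ⊥E (⊢-[] θ d)

  -- Parameter-only and NNIL(par) formulas

  []-par : (θ : Subst) (A : F) → (∀ a → Occ a A → IsPar a) → A [ θ ] ≡ A
  []-par θ (at (var x)) h = ⊥-elim (h (var x) here)
  []-par θ (at (par p)) h = refl
  []-par θ ⊥̇            h = refl
  []-par θ (A ∧̇ B)      h = cong₂ _∧̇_ ([]-par θ A (λ a → h a ∘ ∧ₗ)) ([]-par θ B (λ a → h a ∘ ∧ᵣ))
  []-par θ (A ∨̇ B)      h = cong₂ _∨̇_ ([]-par θ A (λ a → h a ∘ ∨ₗ)) ([]-par θ B (λ a → h a ∘ ∨ᵣ))
  []-par θ (A ⇒ B)      h = cong₂ _⇒_ ([]-par θ A (λ a → h a ∘ ⇒ₗ)) ([]-par θ B (λ a → h a ∘ ⇒ᵣ))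

  -- Soundness of `sub` rests on this: substituting throughout a derivation changes its conclusion
  -- but leaves such a context as it was.
  map-[]-par : (θ : Subst) → All NNILpar Γ → map (_[ θ ]) Γ ≡ Γ
  map-[]-par θ []                = refl
  map-[]-par θ ((_ , h) ∷ ns) = cong₂ _∷_ ([]-par θ _ h) (map-[]-par θ ns)

  NNILpar-∧ : NNILpar (A ∧̇ B) → NNILpar A × NNILpar B
  NNILpar-∧ (∧ₙ m n , h) = (m , λ a → h a ∘ ∧ₗ) , (n , λ a → h a ∘ ∧ᵣ)

  NNILpar-∨ : NNILpar (A ∨̇ B) → NNILpar A × NNILpar B
  NNILpar-∨ (∨ₙ m n , h) = (m , λ a → h a ∘ ∨ₗ) , (n , λ a → h a ∘ ∨ᵣ)

  NNILpar-⇒ : NNILpar (A ⇒ B) → Pos A × NNILpar B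
  -- `⊤̇` is itself the implication `⊥̇ ⇒ ⊥̇`, so `⊤ₙ` also matches here.
  NNILpar-⇒ (⊤ₙ , h)     = ⊥ₚ , ⊥ₙ , λ a → h a ∘ ⇒ᵣ
  NNILpar-⇒ (⇒ₙ p n , h) = p , n , λ a → h a ∘ ⇒ᵣ

  -- Saturation of contexts

  infix 4 _≟_
  _≟_ : DecidableEquality (Atom nv np)
  var x ≟ var y = map′ (cong var) (λ { refl → refl }) (x ≟ᶠ y)
  var x ≟ par q = no λ ()
  par p ≟ var y = no λ ()
  par p ≟ par q = map′ (cong par) (λ { refl → refl }) (p ≟ᶠ q)

  True : List (Atom nv np) → F → Set
  True X (at a)  = a ∈ X
  True X ⊥̇       = ⊥
  True X (A ∧̇ B) = True X A × True X B
  True X (A ∨̇ B) = True X A ⊎ True X B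
  True X (A ⇒ B) = True X A → True X B

  true? : ∀ X A → Dec (True X A)
  true? X (at a)  = Any.any? (a ≟_) X
  true? X ⊥̇       = no id
  true? X (A ∧̇ B) = true? X A ×-dec true? X B
  true? X (A ∨̇ B) = true? X A ⊎-dec true? X B
  true? X (A ⇒ B) = true? X A →-dec true? X B

  -- `X` collects the atoms already extracted and `W` is the worklist; it stands in front so that
  -- its head is the head of the context.
  ctx : List (Atom nv np) → List F → List F
  ctx X W = W ++ map at X

  ∈-atoms : ∀ {X a} W → a ∈ X → at a ∈ ctx X W
  ∈-atoms W i = ∈-++⁺ʳ W (∈-map⁺ at i)

  -- Truth of a positive formula is witnessed by atoms of `X`. So an implication whose positive
  -- antecedent is true can be fired by modus ponens.
  True⇒⊢ : ∀ {X} W → Pos A → True X A → ctx X W ⊢ A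
  True⇒⊢ W (atₚ a)  t          = hyp (∈-atoms W t)
  True⇒⊢ W ⊤ₚ       t          = ⇒I (hyp (here refl))
  True⇒⊢ W (∧ₚ p q) (s , t)    = ∧I (True⇒⊢ W p s) (True⇒⊢ W q t)
  True⇒⊢ W (∨ₚ p q) (inj₁ s)   = ∨I₁ (True⇒⊢ W p s)
  True⇒⊢ W (∨ₚ p q) (inj₂ t)   = ∨I₂ (True⇒⊢ W q t)

  data Stuck (X : List (Atom nv np)) : F → Set where
    stuck : ¬ True X A → Stuck X (A ⇒ B)

  data Reducible (X : List (Atom nv np)) : F → Set where
    at-red : ∀ {a} → Reducible X (at a)
    ⊥-red  : Reducible X ⊥̇
    ∧-red  : Reducible X (A ∧̇ B)
    ∨-red  : Reducible X (A ∨̇ B)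
    ⇒-red  : True X A → Reducible X (A ⇒ B)

  stuck⊎reducible : ∀ X A → Stuck X A ⊎ Reducible X A
  stuck⊎reducible X (at a)  = inj₂ at-red
  stuck⊎reducible X ⊥̇       = inj₂ ⊥-red
  stuck⊎reducible X (A ∧̇ B) = inj₂ ∧-red
  stuck⊎reducible X (A ∨̇ B) = inj₂ ∨-red
  stuck⊎reducible X (A ⇒ B) with true? X A
  ... | yes t = inj₂ (⇒-red t)
  ... | no ¬t = inj₁ (stuck ¬t)

  size : F → ℕ
  size (at a)  = 1
  size ⊥̇       = 1
  size (A ∧̇ B) = suc (size A + size B)
  size (A ∨̇ B) = suc (size A + size B)
  size (A ⇒ B) = suc (size A + size B)

  sizes : List F → ℕ
  sizes = sum ∘ map size

  -- Quantifying over all saturated contexts that derive `Γ` replaces an explicit finite list of the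
  -- saturated contexts covering `Γ`.
  SaturatedBelow : List F → F → Set
  SaturatedBelow Γ A = ∀ X W → All NNILpar (ctx X W) → All (Stuck X) W →
                       ctx X W ⊢* Γ → ctx X W ⊢ A

  SaturatedBelow-mono : Δ ⊢* Γ → SaturatedBelow Γ A → SaturatedBelow Δ A
  SaturatedBelow-mono σ k X W ns ss τ = k X W ns ss (cut τ ∘ σ)

  -- `n` is fuel bounding the size of the worklist. Moving an atom to `X` can turn a stuck
  -- implication reducible, but each step shrinks `W`: atoms leave it, conjunctions split,
  -- disjunctions branch, fired implications become their consequents, and `⊥̇` ends the branch.
  saturate : ∀ n X W → sizes W < n → All NNILpar (ctx X W) →
             SaturatedBelow (ctx X W) A → ctx X W ⊢ A
  saturate-red : ∀ n X W → sizes (B ∷ W) < suc n → Reducible X B → All NNILpar (ctx X (B ∷ W)) →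
                 SaturatedBelow (ctx X (B ∷ W)) A → ctx X (B ∷ W) ⊢ A

  saturate (suc n) X W lt ns k with All.decide (stuck⊎reducible X) W
  ... | inj₁ ss = k X W ns ss hyp
  ... | inj₂ r with find r
  ...   | B , B∈W , red with ∈-∃++ B∈W
  ...     | ys , zs , refl =
    rename (∈-resp-↭ (↭-sym π))
      (saturate-red n X (ys ++ zs) (subst (_< suc n) (sum-↭ (map⁺ size W↭)) lt) red
        (All-resp-↭ π ns) (SaturatedBelow-mono (hyp ∘ ∈-resp-↭ π) k))
    where
    W↭ : W ↭ B ∷ ys ++ zs
    W↭ = shift B ys zs
    π : ctx X W ↭ ctx X (B ∷ ys ++ zs)
    π = ++⁺ʳ (map at X) W↭

  saturate-red n X W lt (at-red {a}) ns k =
    rename (∈-resp-↭ π)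
      (saturate n (a ∷ X) W (≤-pred lt) (All-resp-↭ (↭-sym π) ns)
        (SaturatedBelow-mono (hyp ∘ ∈-resp-↭ (↭-sym π)) k))
    where
    π : ctx (a ∷ X) W ↭ at a ∷ ctx X W
    π = shift (at a) W (map at X)
  saturate-red n X W lt ⊥-red ns k = ⊥E (hyp (here refl))
  saturate-red n X W lt (∧-red {A} {B}) (m ∷ ns) k =
    cut (∷-⊢* (∧E₁ (hyp (here refl))) (∷-⊢* (∧E₂ (hyp (here refl))) (hyp ∘ there)))
      (saturate n X (A ∷ B ∷ W)
        (subst (_< n) (+-assoc (size A) (size B) (sizes W)) (≤-pred lt))
        (proj₁ (NNILpar-∧ m) ∷ proj₂ (NNILpar-∧ m) ∷ ns)
        (SaturatedBelow-mono
          (∷-⊢* (∧I (hyp (here refl)) (hyp (there (here refl)))) (hyp ∘ there ∘ there)) k))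
  saturate-red n X W lt (∨-red {A} {B}) (m ∷ ns) k =
    ∨E (hyp (here refl))
      (rename (∷⁺ʳ _ there)
        (saturate n X (A ∷ W)
          (<-≤-trans (+-monoˡ-< (sizes W) (s≤s (m≤m+n (size A) (size B)))) (≤-pred lt))
          (proj₁ (NNILpar-∨ m) ∷ ns)
          (SaturatedBelow-mono (∷-⊢* (∨I₁ (hyp (here refl))) (hyp ∘ there)) k)))
      (rename (∷⁺ʳ _ there)
        (saturate n X (B ∷ W)
          (<-≤-trans (+-monoˡ-< (sizes W) (s≤s (m≤n+m (size B) (size A)))) (≤-pred lt))
          (proj₂ (NNILpar-∨ m) ∷ ns)
          (SaturatedBelow-mono (∷-⊢* (∨I₂ (hyp (here refl))) (hyp ∘ there)) k)))
  saturate-red n X W lt (⇒-red {A} {B} t) (m ∷ ns) k =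
    cut (∷-⊢* (⇒E (hyp (here refl)) (weaken (True⇒⊢ W (proj₁ (NNILpar-⇒ m)) t))) (hyp ∘ there))
      (saturate n X (B ∷ W)
        (<-≤-trans (+-monoˡ-< (sizes W) (s≤s (m≤n+m (size B) (size A)))) (≤-pred lt))
        (proj₂ (NNILpar-⇒ m) ∷ ns)
        -- `B` gives back `A ⇒ B`, so a saturated context deriving the reduced context also derives
        -- the original one.
        (SaturatedBelow-mono (∷-⊢* (⇒I (weaken (hyp (here refl)))) (hyp ∘ there)) k))

  saturation : All NNILpar Γ → SaturatedBelow Γ A → Γ ⊢ A
  saturation {Γ} ns k =
    rename (subst (_ ∈_) (++-identityʳ Γ))
      (saturate (suc (sizes Γ)) [] Γ (n<1+n _)
        (All.++⁺ ns [])
        (SaturatedBelow-mono (hyp ∘ subst (_ ∈_) (sym (++-identityʳ Γ))) k))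

  -- The Aczel slash

  -- The slash for Θ with atoms true exactly on X. Every clause may be discharged by R, the
  -- disjunction to be established, which spares the case distinction on whether R holds.
  module Slash (Θ : List F) (X : List (Atom nv np)) (X⊢ : Θ ⊢* map at X) (R : Set) where

    Sl : F → Set
    Sl (at a)  = a ∈ X ⊎ R
    Sl ⊥̇       = R
    Sl (A ∧̇ B) = Sl A × Sl B
    Sl (A ∨̇ B) = Sl A ⊎ Sl B
    Sl (A ⇒ B) = ((Θ ⊢ A ⇒ B) × (Sl A → Sl B)) ⊎ R

    R⇒Sl : ∀ A → R → Sl A
    R⇒Sl (at a)  r = inj₂ r
    R⇒Sl ⊥̇       r = r
    R⇒Sl (A ∧̇ B) r = R⇒Sl A r , R⇒Sl B r
    R⇒Sl (A ∨̇ B) r = inj₁ (R⇒Sl A r)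
    R⇒Sl (A ⇒ B) r = inj₂ r

    Sl⇒⊢ : ∀ A → Sl A → Θ ⊢ A ⊎ R
    Sl⇒⊢ (at a)  (inj₁ i) = inj₁ (X⊢ (∈-map⁺ at i))
    Sl⇒⊢ (at a)  (inj₂ r) = inj₂ r
    Sl⇒⊢ ⊥̇       r        = inj₂ r
    Sl⇒⊢ (A ∧̇ B) (s , t) with Sl⇒⊢ A s | Sl⇒⊢ B t
    ... | inj₁ d | inj₁ e = inj₁ (∧I d e)
    ... | inj₂ r | _      = inj₂ r
    ... | _      | inj₂ r = inj₂ r
    Sl⇒⊢ (A ∨̇ B) (inj₁ s) = map₁ ∨I₁ (Sl⇒⊢ A s)
    Sl⇒⊢ (A ∨̇ B) (inj₂ t) = map₁ ∨I₂ (Sl⇒⊢ B t)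
    Sl⇒⊢ (A ⇒ B) s        = map₁ proj₁ s

    -- `Sl D` yields `Θ ⊢ D` only up to `R`. Storing the derivation as well lets the `⇒I` case of
    -- soundness close by `cut`.
    SlCtx : List F → Set
    SlCtx = All λ D → (Θ ⊢ D) × Sl D

    SlCtx⇒⊢* : SlCtx Δ → Θ ⊢* Δ
    SlCtx⇒⊢* σ i = proj₁ (All.lookup σ i)

    Sl-sound : SlCtx Δ → Δ ⊢ A → Sl A
    Sl-sound-∷ : SlCtx Δ → (B ∷ Δ) ⊢ A → Sl B → Sl A

    Sl-sound σ (hyp i)  = proj₂ (All.lookup σ i)
    Sl-sound σ (⇒I d)   = inj₁ (cut (SlCtx⇒⊢* σ) (⇒I d) , Sl-sound-∷ σ d)
    Sl-sound σ (⇒E {B = B} d e) = [ (λ s → proj₂ s (Sl-sound σ e)) , R⇒Sl B ]′ (Sl-sound σ d)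
    Sl-sound σ (∧I d e) = Sl-sound σ d , Sl-sound σ e
    Sl-sound σ (∧E₁ d)  = proj₁ (Sl-sound σ d)
    Sl-sound σ (∧E₂ d)  = proj₂ (Sl-sound σ d)
    Sl-sound σ (∨I₁ d)  = inj₁ (Sl-sound σ d)
    Sl-sound σ (∨I₂ d)  = inj₂ (Sl-sound σ d)
    Sl-sound σ (∨E d e f) = [ Sl-sound-∷ σ e , Sl-sound-∷ σ f ]′ (Sl-sound σ d)
    Sl-sound σ (⊥E {A} d) = R⇒Sl A (Sl-sound σ d)

    Sl-sound-∷ {B = B} {A = A} σ d s =
      [ (λ e → Sl-sound ((e , s) ∷ σ) d) , R⇒Sl A ]′ (Sl⇒⊢ B s)

    Sl⇒True : Pos A → Sl A → True X A ⊎ R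
    Sl⇒True (atₚ a)  s        = s
    Sl⇒True ⊥ₚ       r        = inj₂ r
    Sl⇒True ⊤ₚ       _        = inj₁ id
    Sl⇒True (∧ₚ p q) (s , t) with Sl⇒True p s | Sl⇒True q t
    ... | inj₁ x | inj₁ y = inj₁ (x , y)
    ... | inj₂ r | _      = inj₂ r
    ... | _      | inj₂ r = inj₂ r
    Sl⇒True (∨ₚ p q) (inj₁ s) = map₁ inj₁ (Sl⇒True p s)
    Sl⇒True (∨ₚ p q) (inj₂ t) = map₁ inj₂ (Sl⇒True q t)

    -- The slash condition holds vacuously up to `R`: a slashed positive antecedent would be true
    -- under `X`, which stuckness excludes.
    Sl-stuck : NNILpar A → Stuck X A → Θ ⊢ A → Sl A
    Sl-stuck n (stuck {B = C} ¬t) d =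
      inj₁ (d , λ s → R⇒Sl C ([ ⊥-elim ∘ ¬t , id ]′ (Sl⇒True (proj₁ (NNILpar-⇒ n)) s)))

    Sl-⋁ : ∀ Es → Sl (⋁ Es) → Any Sl Es ⊎ R
    Sl-⋁ []           r        = inj₂ r
    Sl-⋁ (E ∷ [])     s        = inj₁ (here s)
    Sl-⋁ (E ∷ G ∷ Es) (inj₁ s) = inj₁ (here s)
    Sl-⋁ (E ∷ G ∷ Es) (inj₂ s) = map₁ there (Sl-⋁ (G ∷ Es) s)

    Sl-⋀ : ∀ As → All Sl As → Sl (⋀ As)
    Sl-⋀ []           []       = inj₁ (⇒I (hyp (here refl)) , id)
    Sl-⋀ (A ∷ [])     (s ∷ []) = s
    Sl-⋀ (A ∷ B ∷ As) (s ∷ ss) = s , Sl-⋀ (B ∷ As) ss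

    -- The consequents are never inspected: slashing an antecedent already yields `R`, and `R`
    -- slashes everything.
    Sl-imps : ∀ EFs → (∀ {E} → E ∈ antes EFs → Sl E → R) → Θ ⊢* imps EFs → All Sl (imps EFs)
    Sl-imps []              h τ = []
    Sl-imps ((E , G) ∷ EFs) h τ =
      inj₁ (τ (here refl) , R⇒Sl G ∘ h (here refl)) ∷ Sl-imps EFs (h ∘ there) (τ ∘ there)

  -- The extended disjunction property

  ⋀-elim : ∀ As → Γ ⊢ ⋀ As → Γ ⊢* As
  ⋀-elim (A ∷ [])     d (here refl) = d
  ⋀-elim (A ∷ B ∷ As) d (here refl) = ∧E₁ d
  ⋀-elim (A ∷ B ∷ As) d (there i)   = ⋀-elim (B ∷ As) (∧E₂ d) i

  -- Take the slash for `H` together with the context. Atoms of `X` and stuck implications are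
  -- slashed, and so is `H`, since a slashed antecedent is one of the disjuncts sought. By soundness
  -- `⋁ Es` is slashed, which selects a disjunct or gives `R` outright.
  saturated-disjunction : ∀ X W EFs Es → All NNILpar (ctx X W) → All (Stuck X) W →
    ctx X W ⊢ ⋀ (imps EFs) ⇒ ⋁ Es →
    Any (λ E → ctx X W ⊢ ⋀ (imps EFs) ⟦ E ⟧) (antes EFs ++ Es)
  saturated-disjunction X W EFs Es ns ss d =
    [ Sl-disjunct (∈-++⁺ʳ (antes EFs)) , id ]′ (Sl-⋁ Es (Sl-sound σ (⇒I⁻¹ d)))
    where
    H : F
    H = ⋀ (imps EFs)
    R : Set
    R = Any (λ E → ctx X W ⊢ H ⟦ E ⟧) (antes EFs ++ Es)
    open Slash (H ∷ ctx X W) X (hyp ∘ there ∘ ∈-++⁺ʳ W) R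

    Sl⇒⟦⟧ : ∀ E → Sl E → ctx X W ⊢ H ⟦ E ⟧ ⊎ R
    -- This is where the shape of the bracket comes from: a slashed parameter lies in `X` and is
    -- derivable without `H`, and a slash of `⊥̇` is `R` itself. Otherwise `H` is discharged.
    Sl⇒⟦⟧ (at (par p))   s = map₁ (hyp ∘ ∈-atoms W) s
    Sl⇒⟦⟧ ⊥̇              s = inj₂ s
    Sl⇒⟦⟧ E@(at (var x)) s = map₁ ⇒I (Sl⇒⊢ E s)
    Sl⇒⟦⟧ E@(_ ∧̇ _)      s = map₁ ⇒I (Sl⇒⊢ E s)
    Sl⇒⟦⟧ E@(_ ∨̇ _)      s = map₁ ⇒I (Sl⇒⊢ E s)
    Sl⇒⟦⟧ E@(_ ⇒ _)      s = map₁ ⇒I (Sl⇒⊢ E s)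

    Sl∈⇒R : ∀ {E} → E ∈ antes EFs ++ Es → Sl E → R
    Sl∈⇒R {E} i s = [ (λ e → Any.map (λ { refl → e }) i) , id ]′ (Sl⇒⟦⟧ E s)

    Sl-disjunct : Es ⊆ antes EFs ++ Es → Any Sl Es → R
    Sl-disjunct ι a with find a
    ... | _ , i , s = Sl∈⇒R (ι i) s

    σ : SlCtx (H ∷ ctx X W)
    σ = (hyp (here refl) ,
         Sl-⋀ (imps EFs) (Sl-imps EFs (Sl∈⇒R ∘ Any.++⁺ˡ) (⋀-elim (imps EFs) (hyp (here refl)))))
      ∷ All.tabulate (λ i → hyp (there i) , Sl-member i)
      where
      Sl-member : ∀ {D} → D ∈ ctx X W → Sl D
      Sl-member i with ∈-++⁻ W i
      ... | inj₁ j = Sl-stuck (All.lookup ns i) (All.lookup ss j) (hyp (there i))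
      ... | inj₂ j with ∈-map⁻ at j
      ...   | a , a∈X , refl = inj₁ a∈X

  -- Soundness for preservativity

  ⟦⟧-elim : ∀ E → Γ ⊢ B → Γ ⊢ B ⟦ E ⟧ → Γ ⊢ E
  ⟦⟧-elim (at (var x)) b d = ⇒E d b
  ⟦⟧-elim (at (par p)) b d = d
  ⟦⟧-elim ⊥̇            b d = d
  ⟦⟧-elim (_ ∧̇ _)      b d = ⇒E d b
  ⟦⟧-elim (_ ∨̇ _)      b d = ⇒E d b
  ⟦⟧-elim (_ ⇒ _)      b d = ⇒E d b

  ⋁-map⟦⟧-intro : ∀ Es → Any (λ E → Γ ⊢ B ⟦ E ⟧) Es → Γ ⊢ ⋁ (map⟦⟧ B Es)
  ⋁-map⟦⟧-intro (E ∷ [])     (here d)  = d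
  ⋁-map⟦⟧-intro (E ∷ G ∷ Es) (here d)  = ∨I₁ d
  ⋁-map⟦⟧-intro (E ∷ G ∷ Es) (there a) = ∨I₂ (⋁-map⟦⟧-intro (G ∷ Es) a)

  -- Contexts make the induction go through: `Mont` adds the parameter `p` as a hypothesis, while
  -- `V` and `Disj` pass to saturated contexts.
  AR-sound : AR⊢ A ▷ B → All NNILpar Γ → Γ ⊢ A → Γ ⊢ B
  AR-sound (Ax d)     ns a = apply d a
  AR-sound (V EFs Es) ns a = saturation ns λ X W ms ss τ →
    ⋁-map⟦⟧-intro (antes EFs ++ Es) (saturated-disjunction X W EFs Es ms ss (cut τ a))
  AR-sound (sub {A} θ) ns a = subst (_⊢ A [ θ ]) (map-[]-par θ ns) (⊢-[] θ a)
  AR-sound (Conj r s) ns a = ∧I (AR-sound r ns a) (AR-sound s ns a)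
  AR-sound (Cut r s)  ns a = AR-sound s ns (AR-sound r ns a)
  AR-sound {B = G} (Disj {B = B} {C = C} r s) ns a = saturation ns λ X W ms ss τ →
    -- The ordinary disjunction property is the extended one with no implications, where `⋀ []` is
    -- `⊤̇` and the bracket can be undone.
    let ⊤⊢ = ⇒I (hyp (here refl))
        side : Any (λ E → ctx X W ⊢ ⊤̇ ⟦ E ⟧) (B ∷ C ∷ []) → ctx X W ⊢ G
        side = λ { (here b)         → AR-sound r ms (⟦⟧-elim B ⊤⊢ b)
                 ; (there (here c)) → AR-sound s ms (⟦⟧-elim C ⊤⊢ c) }
    in side (saturated-disjunction X W [] (B ∷ C ∷ []) ms ss (⇒I (weaken (cut τ a))))
  AR-sound (Mont p r) ns a =
    ⇒I (AR-sound r ((atₙ (par p) , λ { _ here → tt }) ∷ ns) (⇒I⁻¹ a))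

  AR⇒Pres : AR⊢ A ▷ B → Pres NNILpar A B
  AR⇒Pres r E n d = ⇒I (AR-sound r (n ∷ []) (⇒I⁻¹ d))

-- The equivalences

theorem4p22 : {nv np : ℕ} (⋆ : Fm nv np → Fm nv np) → IsStar ⋆ →
    (A B : Fm nv np) →
    ((AR⊢ A ▷ B) ⇔ Pres NNILpar A B) × (Pres NNILpar A B ⇔ IPC⊢ (⋆ A ⇒ B))
theorem4p22 ⋆ star A B with star A
... | nnil , ⋆A⇒A , A▷⋆A , _ =
  mk⇔ AR⇒Pres (⋆⇒AR ∘ Pres⇒⋆) , mk⇔ Pres⇒⋆ (AR⇒Pres ∘ ⋆⇒AR)
  where
  Pres⇒⋆ : Pres NNILpar A B → IPC⊢ (⋆ A ⇒ B)
  -- Preservativity is tested at `⋆ A` itself, where the premise is the property `⋆ A ⇒ A` of the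
  -- star.
  Pres⇒⋆ h = h (⋆ A) nnil ⋆A⇒A

  ⋆⇒AR : IPC⊢ (⋆ A ⇒ B) → AR⊢ A ▷ B
  ⋆⇒AR d = Cut A▷⋆A (Ax d)
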